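{- (i) For every finite alphabet $\Sigma$, every language of infinite pictures $L \subseteq \Sigma^{\omega,\omega}$ which is accepted row by row by an ordinal Büchi automaton is Büchi-recognized by some finite tiling system. (ii) The converse is not true: there exist a finite alphabet $\Sigma$ and a language of infinite pictures $L \subseteq \Sigma^{\omega,\omega}$ which is Büchi-recognized by a finite tiling system but is not accepted row by row by any ordinal Büchi automaton.
   Context: Pictures. Let $\Sigma$ be a finite alphabet, $\#\notin\Sigma$ a border letter, and $\hat{\Sigma}=\Sigma\cup\{\#\}$. An $\omega$-picture (infinite picture) over $\Sigma$ is a function $p:\omega\times\omega\to\hat{\Sigma}$ such that $p(i,0)=p(0,i)=\#$ for all $i\ge 0$ and $p(i,j)\in\Sigma$ for all $i,j>0$. $\Sigma^{\omega,\omega}$ is the set of all $\omega$-pictures over $\Sigma$; a language of infinite pictures is a subset of $\Sigma^{\omega,\omega}$. Tiling systems. A (finite) tiling system is a tuple $\mathcal{A}=(Q,\Sigma,\Delta)$ with $Q$ a finite set of states, $\Sigma$ a finite alphabet, and $\Delta\subseteq(\hat{\Sigma}\times Q)^4$ a finite set of tiles, written $\left(\begin{array}{cc}(a_3,q_3)&(a_4,q_4)\\(a_1,q_1)&(a_2,q_2)\end{array}\right)$. A run of $\mathcal{A}$ on $p\in\Sigma^{\omega,\omega}$ is a map $\rho:\omega\times\omega\to Q$ such that for all $(i,j)\in\omega\times\omega$ the tile $$\left(\begin{array}{cc}(p(i,j+1),\rho(i,j+1))&(p(i+1,j+1),\rho(i+1,j+1))\\(p(i,j),\rho(i,j))&(p(i+1,j),\rho(i+1,j))\end{array}\right)$$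 belongs to $\Delta$. For $F\subseteq Q$, the language Büchi-recognized by $(\mathcal{A},F)$ is the set of $p\in\Sigma^{\omega,\omega}$ for which there is a run $\rho$ of $\mathcal{A}$ on $p$ with $\rho(v)\in F$ for infinitely many $v\in\omega\times\omega$. Ordinal Büchi automata. An ordinal Büchi automaton is $\mathcal{B}=(\Sigma,Q,q_0,\Delta,\gamma,F)$ with $\Sigma$ a finite alphabet, $Q$ a finite set of states, $q_0\in Q$ the initial state, $\Delta\subseteq Q\times\Sigma\times Q$ the transition relation, $\gamma\subseteq P(Q)\times Q$ the transition relation for limit steps, and $F\subseteq Q$ the set of final states. A run on a word $\sigma\in\Sigma^{\alpha}$ ($\alpha$ a countable ordinal) is an $(\alpha+1)$-sequence $x$ of states with $x(0)=q_0$, $(x(i),\sigma(i),x(i+1))\in\Delta$ for all $i<\alpha$, and $(\mathrm{Inf}(x,i),x(i))\in\gamma$ for every limit ordinal $i\le\alpha$, where $\mathrm{Inf}(x,i)=\{q\in Q\mid\forall\mu<i\ \exists\nu<i\ (\mu<\nu\text{ and }x(\nu)=q)\}$. The run is successful if $x(\alpha)\in F$; $\sigma$ is accepted if there is a successful run on $\sigma$. An $\omega^2$-language (subset of $\Sigma^{\omega^2}$) is regular if it is the set of words of length $\omega^2$ accepted by some ordinal Büchi automaton. Row-by-row acceptance. To $p\in\Sigma^{\omega,\omega}$ associate the $\omega^2$-word $\bar p\in\Sigma^{\omega^2}$ given by $\bar p(\omega\cdot n+m)=p(m+1,n+1)$ for all integers $n,m\ge 0$, and put $\bar L=\{\bar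 p\mid p\in L\}$. The language $L\subseteq\Sigma^{\omega,\omega}$ is accepted row by row by an ordinal Büchi automaton if and only if $\bar L$ is a regular $\omega^2$-language. -}

module Defs where

open import Data.Fin.Base using (Fin)
open import Data.Fin.Subset using (Subset) renaming (_∈_ to _∈ₛ_)
open import Data.List.Base using (List)
open import Data.List.Membership.Propositional using (_∉_)
open import Data.Maybe.Base using (Maybe; just; nothing)
open import Data.Nat.Base using (ℕ; suc) renaming (_<_ to _<ℕ_)
import Data.Nat.Induction as ℕ
import Data.Nat.Properties as ℕ
open import Data.Product.Base using (_×_; _,_; ∃-syntax; Σ-syntax; proj₁)
open import Data.Product.Relation.Binary.Lex.Strict
  using (×-Lex; ×-wellFounded; ×-isStrictTotalOrder)
open import Data.Product.Relation.Binary.Pointwise.NonDependent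
  using (≡×≡⇒≡; ≡⇒≡×≡)
open import Function.Base using (_∘_)
open import Function.Bundles using (_↔_; _⇔_)
open import Induction.WellFounded using (WellFounded)
open import Level using (0ℓ)
open import Relation.Binary.Core using (Rel)
open import Relation.Binary.Definitions
  using (Trichotomous; tri<; tri≈; tri>; _Respects_)
import Relation.Binary.Construct.Add.Supremum.Strict as AddSup
open import Relation.Binary.PropositionalEquality
  using (_≡_; _≗_; refl; isEquivalence)
open import Relation.Binary.Structures using (IsStrictTotalOrder)
open import Relation.Nullary.Construct.Add.Supremum using (_⁺; [_]; ⊤⁺)
open import Relation.Nullary.Negation.Core using (¬_)
open import Relation.Unary using (Pred; _≐_; _∈_)

Finite : Set → Set
Finite A = ∃[ k ] (A ↔ Fin k)

-- No finite list of elements exhausts P.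
Infinite : {A : Set} → Pred A 0ℓ → Set
Infinite {A} P = (xs : List A) → ∃[ v ] (v ∉ xs × P v)

-- The extended alphabet  A ∪ {#}  is  Maybe A.
pattern # = nothing

record Picture (A : Set) : Set where
  field
    at       : ℕ × ℕ → Maybe A
    bottom   : ∀ i → at (i , 0) ≡ #
    left     : ∀ i → at (0 , i) ≡ #
    interior : ∀ i j → ∃[ a ] (at (suc i , suc j) ≡ just a)

open Picture public

letter : {A : Set} → Picture A → ℕ → ℕ → A
letter p i j = proj₁ (interior p i j)

_≈_ : {A : Set} → Rel (Picture A) 0ℓ
p ≈ p′ = at p ≗ at p′

-- Pictures are functions, so in the absence of function extensionality
-- a set of pictures is a predicate that respects pointwise equality.
record Language (A : Set) : Set₁ where
  field
    pred     : Pred (Picture A) 0ℓ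
    respects : pred Respects _≈_

open Language public

-- State sets, here and below, are Fin n.
record TilingSystem (A : Set) : Set₁ where
  field
    states : ℕ

  State : Set
  State = Fin states

  Cell : Set
  Cell = Maybe A × State

  field
    -- Corners are listed in the order (a₁,q₁), (a₂,q₂), (a₃,q₃), (a₄,q₄):
    -- bottom left, bottom right, top left, top right.
    Δ : Pred (Cell × Cell × Cell × Cell) 0ℓ

module _ {A : Set} (𝒜 : TilingSystem A) where
  open TilingSystem 𝒜

  IsTilingRun : Picture A → (ℕ × ℕ → State) → Set
  IsTilingRun p ρ = ∀ i j →
    (cell i j , cell (suc i) j , cell i (suc j) , cell (suc i) (suc j)) ∈ Δ
    where
    cell : ℕ → ℕ → Cell
    cell i j = at p (i , j) , ρ (i , j)

  BüchiLanguage : Subset states → Pred (Picture A) 0ℓ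
  BüchiLanguage F p =
    ∃[ ρ ] (IsTilingRun p ρ × Infinite (λ v → ρ v ∈ₛ F))

BüchiRecognizable : {A : Set} → Language A → Set₁
BüchiRecognizable {A} L =
  Σ[ 𝒜 ∈ TilingSystem A ] Σ[ F ∈ Subset (TilingSystem.states 𝒜) ]
    (pred L ≐ BüchiLanguage 𝒜 F)

-- Ordinals are represented by well-orders.
record WellOrder : Set₁ where
  field
    Carrier            : Set
    _<_                : Rel Carrier 0ℓ
    isStrictTotalOrder : IsStrictTotalOrder _≡_ _<_
    wellFounded        : WellFounded _<_

Word : Set → WellOrder → Set
Word A α = WellOrder.Carrier α → A

record OrdinalBüchiAutomaton (A : Set) : Set₁ where
  field
    states : ℕ

  State : Set
  State = Fin states

  field
    q₀ : State
    Δ  : Pred (State × A × State) 0ℓ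
    γ  : Pred (Subset states × State) 0ℓ
    F  : Subset states

module _ {A : Set} (ℬ : OrdinalBüchiAutomaton A) (α : WellOrder) where
  open OrdinalBüchiAutomaton ℬ
  open WellOrder α
  open AddSup _<_ using (_<⁺_)

  -- α + 1 is α with a new greatest element ⊤⁺, which plays the role of
  -- the ordinal α itself.
  Position : Set
  Position = Carrier ⁺

  IsZero : Pred Position 0ℓ
  IsZero i = ∀ j → ¬ (j <⁺ i)

  IsSuccessorOf : Rel Position 0ℓ
  IsSuccessorOf j i = i <⁺ j × (∀ k → ¬ (i <⁺ k × k <⁺ j))

  IsLimit : Pred Position 0ℓ
  IsLimit i = ¬ IsZero i × (∀ j → ¬ IsSuccessorOf i j)

  Inf : (Position → State) → Position → Pred State 0ℓ
  Inf x i q = ∀ μ → μ <⁺ i → ∃[ ν ] (ν <⁺ i × μ <⁺ ν × x ν ≡ q)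

  record IsRun (σ : Word A α) (x : Position → State) : Set where
    field
      initial   : ∀ i → IsZero i → x i ≡ q₀
      successor : ∀ i j → IsSuccessorOf j [ i ] → (x [ i ] , σ i , x j) ∈ Δ
      limit     : ∀ i → IsLimit i →
                  ∃[ S ] ((∀ q → q ∈ₛ S ⇔ Inf x i q) × (S , x i) ∈ γ)

  Accepted : Pred (Word A α) 0ℓ
  Accepted σ = ∃[ x ] (IsRun σ x × x ⊤⁺ ∈ₛ F)

Regular : {A : Set} (α : WellOrder) → Pred (Word A α) 0ℓ → Set₁
Regular {A} α W = Σ[ ℬ ∈ OrdinalBüchiAutomaton A ] (W ≐ Accepted ℬ α)

-- The ordinal  ω·n + m < ω²  is the pair (n , m), ordered lexicographically.
ω² : WellOrder
ω² = record
  { Carrier            = ℕ × ℕ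
  ; _<_                = _<ₗₑₓ_
  ; isStrictTotalOrder = record
    { isStrictPartialOrder = record
      { isEquivalence = isEquivalence
      ; irrefl        = Lex.irrefl ∘ ≡⇒≡×≡
      ; trans         = Lex.trans
      ; <-resp-≈      = (λ { refl u → u }) , (λ { refl u → u })
      }
    ; compare = compare
    }
  ; wellFounded        = ×-wellFounded ℕ.<-wellFounded ℕ.<-wellFounded
  }
  where
  _<ₗₑₓ_ : Rel (ℕ × ℕ) 0ℓ
  _<ₗₑₓ_ = ×-Lex _≡_ _<ℕ_ _<ℕ_

  module Lex = IsStrictTotalOrder
    (×-isStrictTotalOrder ℕ.<-isStrictTotalOrder ℕ.<-isStrictTotalOrder)

  compare : Trichotomous _≡_ _<ₗₑₓ_
  compare u v with Lex.compare u v
  ... | tri< a ¬b ¬c = tri< a (¬b ∘ ≡⇒≡×≡) ¬c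
  ... | tri≈ ¬a b ¬c = tri≈ ¬a (≡×≡⇒≡ b) ¬c
  ... | tri> ¬a ¬b c = tri> ¬a (¬b ∘ ≡⇒≡×≡) c

-- letter p m n is the letter at (m + 1 , n + 1).
rowWord : {A : Set} → Picture A → Word A ω²
rowWord p (n , m) = letter p m n

rowWords : {A : Set} → Language A → Pred (Word A ω²) 0ℓ
rowWords L σ = ∃[ p ] (p ∈ pred L × rowWord p ≗ σ)

AcceptedRowByRow : {A : Set} → Language A → Set₁
AcceptedRowByRow L = Regular ω² (rowWords L)

{-# OPTIONS --safe #-}
module Submission where

open import Defs
open import Axiom.ExcludedMiddle using (ExcludedMiddle)
open import Data.Bool.Base using (Bool; true; false; not; _∧_; _∨_; if_then_else_)
open import Data.Bool.Properties using (T-≡; ∧-assoc; ∨-identityʳ)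
open import Data.Empty using (⊥-elim)
open import Data.Fin.Base using (Fin; zero; suc; toℕ)
import Data.Fin.Properties as Fin
open import Data.Fin.Subset using (Subset; _⊆_; ⊥; _∪_; ⁅_⁆)
  renaming (_∈_ to _∈ₛ_; ⊤ to ⊤ₛ)
open import Data.Fin.Subset.Properties
  using (_∈?_; ∉⊥; ⊆-antisym; x∈p∪q⁻; x∈p∪q⁺; p⊆p∪q; q⊆p∪q; x∈⁅y⁆⇒x≡y; x∈⁅x⁆)
  renaming (∈⊤ to ∈⊤ₛ)
open import Data.List.Base using (List; []; _∷_)
open import Data.List.Membership.Propositional using (_∈_)
open import Data.List.Relation.Unary.Any using (here; there)
open import Data.Maybe.Base using (Maybe; just; nothing)
open import Data.Maybe.Properties using (just-injective)
open import Data.Nat.Base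
  using (ℕ; zero; suc; _+_; _≤_; _<_; _<ᵇ_; z≤n; s≤s; _⊔_)
open import Data.Nat.Properties
open import Data.Product.Base using (_×_; _,_; Σ-syntax; ∃-syntax; proj₁; proj₂)
open import Data.Product.Function.NonDependent.Propositional using (_×-↔_)
open import Data.Sum.Base using (_⊎_; inj₁; inj₂)
open import Data.Vec.Base using ([]; _∷_; tabulate)
open import Data.Vec.Properties using (lookup∘tabulate; []=⇒lookup; lookup⇒[]=)
open import Function.Base using (_∘_; case_of_)
open import Function.Bundles using (_↔_; _⇔_; mk⇔; mk↔ₛ′; Equivalence; Inverse)
open import Function.Properties.Equivalence using ()
  renaming (trans to ⇔-trans; sym to ⇔-sym)
open import Function.Properties.Inverse using (↔-refl; ↔-sym; ↔-trans)
open import Level using (0ℓ)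
open import Relation.Binary.Definitions using (tri<; tri≈; tri>)
import Relation.Binary.Construct.Add.Supremum.Strict as AddSup
open import Relation.Binary.PropositionalEquality
  using (_≡_; refl; sym; trans; cong; subst)
open import Relation.Nullary.Construct.Add.Supremum using ([_]; ⊤⁺)
open import Relation.Nullary.Decidable using (yes; no; does; dec-true; dec-false)
open import Relation.Nullary.Negation.Core using (¬_; contradiction)
open import Relation.Unary using (Pred)

-- Both halves rest on reading a run on an ω²-word as a grid of states X n m,
-- where X n m is the state at position ω·n + m, together with a last state
-- at ω² (GridRun, run⇒gridRun, gridRun⇒run).
--
-- (i) The tiling system guesses X and has to verify the limit transitions:
-- the state at ω·(n+1) depends on the set Sₙ of states that recur in row n,
-- and the state at ω² depends on the set of states that occur in infinitely
-- many rows.  That is one Büchi condition for every row and one more for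
-- the sequence of rows, whereas the tiling system has a single one.
--
-- A sequence of sets fₘ is certified to have limit superior S by cutting it
-- into blocks: if there are infinitely many cuts and the union of every
-- block but the first is exactly S, then S is the set of q that lie in
-- infinitely many fₘ (Tracking.recurrent-correct).  Recording also the union
-- of the first block gives all q that occur at all
-- (Tracking.occurring-correct).  A bounded amount of data, a Track, suffices
-- to carry this out from left to right.  Row n carries a track for its
-- states; its recurrent set is Sₙ, and all the states occurring in the row
-- are thereby known at its left end.  A second track, running upwards,
-- treats the sets of states occurring in the successive rows.
--
-- The conditions are merged by requiring that the cuts of row n + 1 be
-- those of row n without the first one.  If infinitely many rows have a
-- cut, then every row has infinitely many, since the first cut of row
-- n + d is also a cut of row n and lies at a column not smaller than n + d
-- (rowCuts).  A cell is accepting if it holds the first cut of its row and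
-- the upward track is cut at this row.  A row has at most one such cell, so
-- infinitely many accepting cells yield infinitely many cuts in every row
-- and in the upward track (labelling⇒gridRun).  Conversely, for an accepting
-- run the columns c 0 < c 1 < ... of the cuts are chosen so that by c n row n
-- has settled in Sₙ, and so that for all n ≤ i all of Sₙ shows up in row n
-- between c i and c (i + 1) (Schedule, gridRun⇒labelling).
--
-- (ii) The pictures all of whose rows are equal are recognized by a tiling
-- system that compares vertically adjacent letters.  An automaton reading
-- them row by row would have to remember the first row in its state at ω:
-- among the infinitely many words with all rows equal to 0ᵏ10^ω two have
-- accepting runs that agree at ω, and splicing these runs accepts a word
-- whose first two rows differ.

-- Runs on ω²-words as grids of states

-- P holds at arbitrarily large numbers.
Recurrent : Pred ℕ 0ℓ → Set
Recurrent P = ∀ N → ∃[ m ] (N ≤ m × P m)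

singleton : ∀ {k} (q r : Fin k) → q ∈ₛ ⁅ r ⁆ ⇔ r ≡ q
singleton q r = mk⇔ (λ q∈ → sym (x∈⁅y⁆⇒x≡y r q∈)) λ { refl → x∈⁅x⁆ r }

∃-cong : {P Q : ℕ → Set} → (∀ n → P n ⇔ Q n) → (∃[ n ] P n) ⇔ (∃[ n ] Q n)
∃-cong P⇔Q = mk⇔
  (λ (n , p) → n , Equivalence.to (P⇔Q n) p)
  (λ (n , q) → n , Equivalence.from (P⇔Q n) q)

Recurrent-cong : {P Q : ℕ → Set} → (∀ n → P n ⇔ Q n) → Recurrent P ⇔ Recurrent Q
Recurrent-cong P⇔Q = mk⇔
  (λ rec N → case rec N of λ (n , N≤n , p) → n , N≤n , Equivalence.to (P⇔Q n) p)
  (λ rec N → case rec N of λ (n , N≤n , q) → n , N≤n , Equivalence.from (P⇔Q n) q)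

module _ {A : Set} (ℬ : OrdinalBüchiAutomaton A) where
  open OrdinalBüchiAutomaton ℬ
  open AddSup (WellOrder._<_ ω²) using (_<⁺_; [_]<⊤⁺) renaming ([_] to ⟨_⟩)

  -- A run on σ, where X n m is the state at position ω·n + m and top is the
  -- state at ω².  A state is visited cofinally below ω² if and only if it
  -- occurs in infinitely many rows.
  record GridRun (σ : Word A ω²) (X : ℕ → ℕ → State) (top : State) : Set where
    field
      initial    : X 0 0 ≡ q₀
      step       : ∀ n m → Δ (X n m , σ (n , m) , X n (suc m))
      rowLimit   : ∀ n → ∃[ S ] ((∀ q → q ∈ₛ S ⇔ Recurrent (λ m → X n m ≡ q)) ×
                                 γ (S , X (suc n) 0))
      finalLimit : ∃[ S ] ((∀ q → q ∈ₛ S ⇔ Recurrent (λ n → ∃[ m ] (X n m ≡ q))) ×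
                           γ (S , top))

  onPositions : (ℕ → ℕ → State) → State → Position ℬ ω² → State
  onPositions X top ⊤⁺        = top
  onPositions X top [ n , m ] = X n m

  rowStart-isLimit : ∀ n → IsLimit ℬ ω² [ suc n , 0 ]
  rowStart-isLimit n =
    (λ z → z [ n , 0 ] ⟨ inj₁ ≤-refl ⟩) , not-successor
    where
    not-successor : ∀ j → ¬ IsSuccessorOf ℬ ω² [ suc n , 0 ] j
    not-successor [ n′ , m ] (⟨ inj₁ n′<1+n ⟩ , gap) =
      gap [ n′ , suc m ] (⟨ inj₂ (refl , ≤-refl) ⟩ , ⟨ inj₁ n′<1+n ⟩)

  final-isLimit : IsLimit ℬ ω² ⊤⁺
  final-isLimit = (λ z → z [ 0 , 0 ] [ 0 , 0 ]<⊤⁺) , not-successor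
    where
    not-successor : ∀ j → ¬ IsSuccessorOf ℬ ω² ⊤⁺ j
    not-successor [ n , m ] (_ , gap) =
      gap [ n , suc m ] (⟨ inj₂ (refl , ≤-refl) ⟩ , [ _ ]<⊤⁺)

  next-isSuccessor : ∀ n m → IsSuccessorOf ℬ ω² [ n , suc m ] [ n , m ]
  next-isSuccessor n m = ⟨ inj₂ (refl , ≤-refl) ⟩ , gap
    where
    gap : ∀ k → ¬ ([ n , m ] <⁺ k × k <⁺ [ n , suc m ])
    gap [ _ ] (⟨ inj₁ n<k ⟩ , ⟨ inj₁ k<n ⟩) = <-asym n<k k<n
    gap [ _ ] (⟨ inj₁ n<k ⟩ , ⟨ inj₂ (refl , _) ⟩) = <-irrefl refl n<k
    gap [ _ ] (⟨ inj₂ (refl , _) ⟩ , ⟨ inj₁ k<n ⟩) = <-irrefl refl k<n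
    gap [ _ ] (⟨ inj₂ (refl , m<k) ⟩ , ⟨ inj₂ (_ , s≤s k≤m) ⟩) =
      <-irrefl refl (≤-trans m<k k≤m)

  successor-unique : ∀ n m j → IsSuccessorOf ℬ ω² j [ n , m ] → j ≡ [ n , suc m ]
  successor-unique n m ⊤⁺ (_ , gap) =
    ⊥-elim (gap [ n , suc m ] (⟨ inj₂ (refl , ≤-refl) ⟩ , [ _ ]<⊤⁺))
  successor-unique n m [ n′ , m′ ] (⟨ inj₁ n<n′ ⟩ , gap) =
    ⊥-elim (gap [ n , suc m ] (⟨ inj₂ (refl , ≤-refl) ⟩ , ⟨ inj₁ n<n′ ⟩))
  successor-unique n m [ n , m′ ] (⟨ inj₂ (refl , m<m′) ⟩ , gap) with m≤n⇒m<n∨m≡n m<m′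
  ... | inj₁ 1+m<m′ = ⊥-elim
    (gap [ n , suc m ] (⟨ inj₂ (refl , ≤-refl) ⟩ , ⟨ inj₂ (refl , 1+m<m′) ⟩))
  ... | inj₂ refl   = refl

  Inf-row : ∀ (x : Position ℬ ω² → State) n q →
            Inf ℬ ω² x [ suc n , 0 ] q ⇔ Recurrent (λ m → x [ n , m ] ≡ q)
  Inf-row x n q = mk⇔ to from
    where
    to : Inf ℬ ω² x [ suc n , 0 ] q → Recurrent (λ m → x [ n , m ] ≡ q)
    to inf N with inf [ n , N ] ⟨ inj₁ ≤-refl ⟩
    ... | [ n′ , m ] , ⟨ inj₁ n′≤n ⟩ , ⟨ inj₁ n<n′ ⟩ , _ =
      contradiction (≤-trans n<n′ (≤-pred n′≤n)) (<-irrefl refl)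
    ... | [ n , m ] , _ , ⟨ inj₂ (refl , N<m) ⟩ , eq = m , <⇒≤ N<m , eq

    from : Recurrent (λ m → x [ n , m ] ≡ q) → Inf ℬ ω² x [ suc n , 0 ] q
    from rec [ n′ , m ] ⟨ inj₁ n′≤n ⟩ with rec (suc m) | m≤n⇒m<n∨m≡n (≤-pred n′≤n)
    ... | k , m<k , eq | inj₁ n′<n = [ n , k ] , ⟨ inj₁ ≤-refl ⟩ , ⟨ inj₁ n′<n ⟩ , eq
    ... | k , m<k , eq | inj₂ refl = [ n , k ] , ⟨ inj₁ ≤-refl ⟩ , ⟨ inj₂ (refl , m<k) ⟩ , eq

  Inf-final : ∀ (x : Position ℬ ω² → State) q →
              Inf ℬ ω² x ⊤⁺ q ⇔ Recurrent (λ n → ∃[ m ] (x [ n , m ] ≡ q))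
  Inf-final x q = mk⇔ to from
    where
    to : Inf ℬ ω² x ⊤⁺ q → Recurrent (λ n → ∃[ m ] (x [ n , m ] ≡ q))
    to inf N with inf [ N , 0 ] [ _ ]<⊤⁺
    ... | [ n , m ] , _ , ⟨ inj₁ N<n ⟩ , eq = n , <⇒≤ N<n , m , eq
    ... | [ n , m ] , _ , ⟨ inj₂ (refl , _) ⟩ , eq = n , ≤-refl , m , eq

    from : Recurrent (λ n → ∃[ m ] (x [ n , m ] ≡ q)) → Inf ℬ ω² x ⊤⁺ q
    from rec [ n , m ] _ with rec (suc n)
    ... | n′ , n<n′ , m′ , eq = [ n′ , m′ ] , [ _ ]<⊤⁺ , ⟨ inj₁ n<n′ ⟩ , eq

  run⇒gridRun : ∀ {σ x} → IsRun ℬ ω² σ x → GridRun σ (λ n m → x [ n , m ]) (x ⊤⁺)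
  run⇒gridRun {σ} {x} run = record
    { initial    = initial _ λ { [ _ ] ⟨ inj₁ () ⟩ ; [ _ ] ⟨ inj₂ (_ , ()) ⟩ }
    ; step       = λ n m → successor (n , m) _ (next-isSuccessor n m)
    ; rowLimit   = λ n → case limit _ (rowStart-isLimit n) of λ
        { (S , S-inf , γS) → S , (λ q → ⇔-trans (S-inf q) (Inf-row x n q)) , γS }
    ; finalLimit = case limit _ final-isLimit of λ
        { (S , S-inf , γS) → S , (λ q → ⇔-trans (S-inf q) (Inf-final x q)) , γS }
    }
    where
    open IsRun run

  gridRun⇒run : ∀ {σ X top} → GridRun σ X top → IsRun ℬ ω² σ (onPositions X top)
  gridRun⇒run {σ} {X} {top} grid = record
    { initial   = initial′
    ; successor = successor′
    ; limit     = limit′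
    }
    where
    open GridRun grid
    x = onPositions X top

    initial′ : ∀ i → IsZero ℬ ω² i → x i ≡ q₀
    initial′ ⊤⁺                z = ⊥-elim (z [ 0 , 0 ] [ _ ]<⊤⁺)
    initial′ [ suc n , m ]     z = ⊥-elim (z [ n , 0 ] ⟨ inj₁ ≤-refl ⟩)
    initial′ [ zero , suc m ]  z = ⊥-elim (z [ 0 , m ] ⟨ inj₂ (refl , ≤-refl) ⟩)
    initial′ [ zero , zero ]   z = initial

    successor′ : ∀ i j → IsSuccessorOf ℬ ω² j [ i ] → Δ (x [ i ] , σ i , x j)
    successor′ (n , m) j s rewrite successor-unique n m j s = step n m

    limit′ : ∀ i → IsLimit ℬ ω² i →
             ∃[ S ] ((∀ q → q ∈ₛ S ⇔ Inf ℬ ω² x i q) × γ (S , x i))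
    limit′ ⊤⁺ _ with finalLimit
    ... | S , S-rec , γS = S , (λ q → ⇔-trans (S-rec q) (⇔-sym (Inf-final x q))) , γS
    limit′ [ n , suc m ] (_ , ¬s) = ⊥-elim (¬s _ (next-isSuccessor n m))
    limit′ [ zero , zero ] (¬z , _) =
      ⊥-elim (¬z λ { [ _ ] ⟨ inj₁ () ⟩ ; [ _ ] ⟨ inj₂ (_ , ()) ⟩ })
    limit′ [ suc n , zero ] _ with rowLimit n
    ... | S , S-rec , γS = S , (λ q → ⇔-trans (S-rec q) (⇔-sym (Inf-row x n q))) , γS

-- Pictures and their letters

-- The picture whose row word is σ.
picture : {A : Set} → Word A ω² → Picture A
picture {A} σ = record
  { at       = cell
  ; bottom   = λ { zero → refl ; (suc i) → refl }
  ; left     = λ { zero → refl ; (suc j) → refl }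
  ; interior = λ i j → σ (j , i) , refl
  }
  where
  cell : ℕ × ℕ → Maybe A
  cell (suc i , suc j) = just (σ (j , i))
  cell _               = nothing

letter-unique : {A : Set} (p : Picture A) → ∀ i j {a} →
                at p (suc i , suc j) ≡ just a → letter p i j ≡ a
letter-unique p i j eq = just-injective (trans (sym (proj₂ (interior p i j))) eq)

letter-cong : {A : Set} (p p′ : Picture A) → p ≈ p′ →
              ∀ i j → letter p i j ≡ letter p′ i j
letter-cong p p′ p≈p′ i j =
  letter-unique p i j (trans (p≈p′ _) (proj₂ (interior p′ i j)))

≈-fromLetters : {A : Set} (p p′ : Picture A) →
                (∀ i j → letter p i j ≡ letter p′ i j) → p ≈ p′
≈-fromLetters p p′ eq (zero , j)      = trans (left p j) (sym (left p′ j))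
≈-fromLetters p p′ eq (suc i , zero)  = trans (bottom p (suc i)) (sym (bottom p′ (suc i)))
≈-fromLetters p p′ eq (suc i , suc j) =
  trans (proj₂ (interior p i j)) (trans (cong just (eq i j)) (sym (proj₂ (interior p′ i j))))

bound : (xs : List (ℕ × ℕ)) → ∃[ N ] (∀ i j → (i , j) ∈ xs → i ≤ N)
bound [] = 0 , λ _ _ ()
bound ((k , _) ∷ xs) with bound xs
... | N , xs≤N = k ⊔ N , λ
  { i j (here refl)  → m≤m⊔n k N
  ; i j (there i∈xs) → ≤-trans (xs≤N i j i∈xs) (m≤n⊔m k N) }

-- Pictures with equal rows: recognizable, but not row by row

module _ {A : Set} (ℬ : OrdinalBüchiAutomaton A) where
  open OrdinalBüchiAutomaton ℬ

  -- Two runs that agree at position ω can be exchanged there: the first row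
  -- of one is followed by all later rows of the other.
  splice : ∀ {σ τ X Y s t} → GridRun ℬ σ X s → GridRun ℬ τ Y t → X 1 0 ≡ Y 1 0 →
           GridRun ℬ (λ { (zero , m) → σ (zero , m) ; (suc n , m) → τ (suc n , m) })
                   (λ { zero → X zero ; (suc n) → Y (suc n) }) t
  splice {X = X} {Y} run-σ run-τ meet = record
    { initial    = S.initial
    ; step       = λ { zero → S.step zero ; (suc n) → T.step (suc n) }
    ; rowLimit   = λ
        { zero    → subst
            (λ q → ∃[ R ] ((∀ p → p ∈ₛ R ⇔ Recurrent (λ m → X 0 m ≡ p)) × γ (R , q)))
            meet (S.rowLimit zero)
        ; (suc n) → T.rowLimit (suc n) }
    -- Row 0 does not matter for recurrence: it is skipped by asking for a
    -- row from suc N on.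
    ; finalLimit = case T.finalLimit of λ
        { (R , R-rec , γR) → R , (λ q → mk⇔
            (λ q∈R N → case Equivalence.to (R-rec q) q∈R (suc N) of λ
               { (suc n , N<n , m , eq) → suc n , <⇒≤ N<n , m , eq })
            (λ rec → Equivalence.from (R-rec q) λ N → case rec (suc N) of λ
               { (suc n , N<n , m , eq) → suc n , <⇒≤ N<n , m , eq })) , γR } }
    where
    module S = GridRun run-σ
    module T = GridRun run-τ

-- Pictures in which every column is constant, that is, all rows are equal.
constantColumns : {A : Set} → Language A
constantColumns = record
  { pred     = λ p → ∀ i j → letter p i j ≡ letter p i (suc j)
  ; respects = λ {p} {p′} p≈p′ const i j →
      trans (sym (letter-cong p p′ p≈p′ i j))
        (trans (const i j) (letter-cong p p′ p≈p′ i (suc j)))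
  }

constantColumns-recognizable : {A : Set} → BüchiRecognizable (constantColumns {A})
constantColumns-recognizable {A} = 𝒜 , ⊤ₛ , (λ {p} → to {p}) , λ {p} → from {p}
  where
  -- The two right-hand letters of a tile must agree.  With a single, final
  -- state every run is accepting.
  𝒜 : TilingSystem A
  𝒜 = record
    { states = 1
    ; Δ      = λ { (_ , (a₂ , _) , _ , (a₄ , _)) →
                   ∀ a b → a₂ ≡ just a → a₄ ≡ just b → a ≡ b } }

  to : ∀ {p} → pred constantColumns p → BüchiLanguage 𝒜 ⊤ₛ p
  to {p} const = (λ _ → zero) , tiles , λ xs → case bound xs of λ
    { (N , xs≤N) → (suc N , 0) , (λ v∈xs → <-irrefl refl (xs≤N _ _ v∈xs)) , ∈⊤ₛ }
    where
    tiles : IsTilingRun 𝒜 p (λ _ → zero)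
    tiles i zero    a b bottom≡a _ = case trans (sym (bottom p _)) bottom≡a of λ ()
    tiles i (suc j) a b eq-a eq-b =
      trans (sym (letter-unique p i j eq-a))
        (trans (const i j) (letter-unique p i (suc j) eq-b))

  from : ∀ {p} → BüchiLanguage 𝒜 ⊤ₛ p → pred constantColumns p
  from {p} (ρ , tiles , _) i j =
    tiles i (suc j) _ _ (proj₂ (interior p i j)) (proj₂ (interior p i (suc j)))

constantColumns-not-rowByRow : ¬ AcceptedRowByRow (constantColumns {Bool})
constantColumns-not-rowByRow (ℬ , words⊆acc , acc⊆words) = absurd
  where
  open OrdinalBüchiAutomaton ℬ

  -- The row with letter true in column k only.
  peak : ℕ → ℕ → Bool
  peak k m = does (m ≟ k)

  repeated : ℕ → Word Bool ω²
  repeated k (n , m) = peak k m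

  accepted : ∀ k → Accepted ℬ ω² (repeated k)
  accepted k = words⊆acc (picture (repeated k) , (λ _ _ → refl) , λ _ → refl)

  stateAtω : ℕ → State
  stateAtω k = proj₁ (accepted k) [ 1 , 0 ]

  -- The spliced word has first row peak k and second row peak l.
  spliced : ∀ k l → stateAtω k ≡ stateAtω l → ∀ m → peak k m ≡ peak l m
  spliced k l meet m with accepted k | accepted l
  ... | x , run-x , _ | y , run-y , final
      with acc⊆words (_ , gridRun⇒run ℬ
             (splice ℬ (run⇒gridRun ℬ run-x) (run⇒gridRun ℬ run-y) meet) , final)
  ... | p , const , p≗ = trans (sym (p≗ (0 , m))) (trans (const m 0) (p≗ (1 , m)))

  absurd : _
  absurd with Fin.pigeonhole (n<1+n states) (stateAtω ∘ toℕ)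
  ... | i , j , i<j , meet = case
    trans (sym (dec-true (toℕ i ≟ toℕ i) refl))
      (trans (spliced (toℕ i) (toℕ j) meet (toℕ i))
        (dec-false (toℕ i ≟ toℕ j) (<⇒≢ i<j))) of λ ()

-- Certifying a limit superior by cuts

-- The data carried along a sequence f of sets to certify which elements
-- recur in it: the claimed set of recurrent elements, the claimed set of
-- elements of the first block, the union of the current block before the
-- current index, whether there was a cut at an earlier index, and whether
-- there is a cut at the current one.  A cut at index m ends a block, and f m
-- still belongs to this block.
record Track (k : ℕ) : Set where
  constructor track
  field
    recurrent transient recent : Subset k
    seen cut                   : Bool

  -- The claimed union of the current block.
  expected : Subset k
  expected = if seen then recurrent else transient

  -- All elements that occur in some block.
  occurring : Subset k
  occurring = recurrent ∪ transient

open Track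

record Start {k} (t : Track k) : Set where
  field
    recent-start : recent t ≡ ⊥
    seen-start   : seen t ≡ false

-- Passing from one index, with set f, to the next.
record Step {k} (f : Subset k) (t t′ : Track k) : Set where
  field
    recurrent-step : recurrent t′ ≡ recurrent t
    transient-step : transient t′ ≡ transient t
    recent-step    : recent t′ ≡ (if cut t then ⊥ else recent t ∪ f)
    seen-step      : seen t′ ≡ seen t ∨ cut t
    check          : cut t ≡ true → recent t ∪ f ≡ expected t

-- h tracks the sequence f.
record Tracks {k} (f : ℕ → Subset k) (h : ℕ → Track k) : Set where
  field
    start : Start (h 0)
    step  : ∀ m → Step (f m) (h m) (h (suc m))

Cut FirstCut : ∀ {k} → Track k → Set
Cut t      = cut t ≡ true
FirstCut t = cut t ≡ true × seen t ≡ false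

module Tracking {k} {f : ℕ → Subset k} {h : ℕ → Track k} (tracks : Tracks f h) where
  open Tracks tracks
  open module StartAt = Start start
  open module StepAt m = Step (step m)

  recurrent-constant : ∀ m → recurrent (h m) ≡ recurrent (h 0)
  recurrent-constant zero    = refl
  recurrent-constant (suc m) = trans (recurrent-step m) (recurrent-constant m)

  transient-constant : ∀ m → transient (h m) ≡ transient (h 0)
  transient-constant zero    = refl
  transient-constant (suc m) = trans (transient-step m) (transient-constant m)

  seen-persists : ∀ {m m′} → m ≤ m′ → seen (h m) ≡ true → seen (h m′) ≡ true
  seen-persists {m} m≤m′ s with m≤n⇒∃[o]m+o≡n m≤m′
  ... | d , refl = go d
    where
    go : ∀ d → seen (h (m + d)) ≡ true
    go zero    rewrite +-identityʳ m = s
    go (suc d) rewrite +-suc m d | seen-step (m + d) | go d = refl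

  cut⇒seen : ∀ {m m′} → m < m′ → Cut (h m) → seen (h m′) ≡ true
  cut⇒seen {m} m<m′ c = seen-persists m<m′ seen-next
    where
    seen-next : seen (h (suc m)) ≡ true
    seen-next rewrite seen-step m | c with seen (h m)
    ... | true  = refl
    ... | false = refl

  seen⇒firstCut : ∀ m → seen (h m) ≡ true → ∃[ m′ ] (m′ < m × FirstCut (h m′))
  seen⇒firstCut zero    s = case trans (sym s) seen-start of λ ()
  seen⇒firstCut (suc m) s rewrite seen-step m with seen (h m) in eq
  ... | false = m , ≤-refl , s , eq
  ... | true  = case seen⇒firstCut m eq of λ { (m′ , m′<m , c) → m′ , m≤n⇒m≤1+n m′<m , c }

  firstCut-unique : ∀ {m m′} → FirstCut (h m) → FirstCut (h m′) → m ≡ m′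
  firstCut-unique {m} {m′} (c , s) (c′ , s′) with <-cmp m m′
  ... | tri< m<m′ _ _ = case trans (sym (cut⇒seen m<m′ c)) s′ of λ ()
  ... | tri≈ _ m≡m′ _ = m≡m′
  ... | tri> _ _ m′<m = case trans (sym (cut⇒seen m′<m c′)) s of λ ()

  -- If a block starts at a, what was collected since then occurs from a on.
  collected⇒occurs : ∀ {q} a d → recent (h a) ≡ ⊥ → q ∈ₛ recent (h (d + a)) →
                     ∃[ j ] (a ≤ j × q ∈ₛ f j)
  collected⇒occurs a zero    empty q∈ = ⊥-elim (∉⊥ (subst (_ ∈ₛ_) empty q∈))
  collected⇒occurs a (suc d) empty q∈ with cut (h (d + a)) | recent-step (d + a)
  ... | true  | eq = ⊥-elim (∉⊥ (subst (_ ∈ₛ_) eq q∈))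
  ... | false | eq with x∈p∪q⁻ _ _ (subst (_ ∈ₛ_) eq q∈)
  ...   | inj₁ q∈recent = collected⇒occurs a d empty q∈recent
  ...   | inj₂ q∈f      = d + a , m≤n+m a d , q∈f

  checked⇒occurs : ∀ {q a m} → recent (h a) ≡ ⊥ → a ≤ m → Cut (h m) → q ∈ₛ expected (h m) →
                   ∃[ j ] (a ≤ j × q ∈ₛ f j)
  checked⇒occurs {q} {a} {m} empty a≤m c q∈
    with x∈p∪q⁻ _ _ (subst (q ∈ₛ_) (sym (check m c)) q∈)
  ... | inj₂ q∈f = m , a≤m , q∈f
  ... | inj₁ q∈recent with m≤n⇒∃[o]m+o≡n a≤m
  ...   | d , refl = collected⇒occurs a d empty
    (subst (λ i → q ∈ₛ recent (h i)) (+-comm a d) q∈recent)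

  -- An element of the current block is checked at the next cut.
  collected⇒checked : ∀ {q} m d → Cut (h (m + d)) → q ∈ₛ recent (h m) ∪ f m →
                      ∃[ m′ ] (m ≤ m′ × q ∈ₛ expected (h m′))
  collected⇒checked {q} m d c q∈ with cut (h m) in eq | recent-step m
  ... | true | _ = m , ≤-refl , subst (q ∈ₛ_) (check m eq) q∈
  collected⇒checked {q} m zero c q∈ | false | _ rewrite +-identityʳ m =
    case trans (sym c) eq of λ ()
  collected⇒checked {q} m (suc d) c q∈ | false | recent≡ rewrite +-suc m d
    with collected⇒checked (suc m) d c (x∈p∪q⁺ (inj₁ (subst (q ∈ₛ_) (sym recent≡) q∈)))
  ... | m′ , m<m′ , q∈′ = m′ , <⇒≤ m<m′ , q∈′

  module _ (cuts : Recurrent (λ m → Cut (h m))) where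

    occurs⇒checked : ∀ {q} m → q ∈ₛ f m → ∃[ m′ ] (m ≤ m′ × q ∈ₛ expected (h m′))
    occurs⇒checked m q∈f with cuts m
    ... | m′ , m≤m′ , c with m≤n⇒∃[o]m+o≡n m≤m′
    ...   | d , refl = collected⇒checked m d c (x∈p∪q⁺ (inj₂ q∈f))

    -- A recurrent element lies in every block but the first, and an element
    -- of any of these blocks is recurrent.
    recurrent-correct : ∀ q → q ∈ₛ recurrent (h 0) ⇔ Recurrent (λ m → q ∈ₛ f m)
    recurrent-correct q = mk⇔ to from
      where
      to : q ∈ₛ recurrent (h 0) → Recurrent (λ m → q ∈ₛ f m)
      to q∈S N with cuts N
      ... | m , N≤m , c with cuts (suc m)
      ...   | m′ , m<m′ , c′ with checked⇒occurs emptied m<m′ c′ q∈expected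
        where
        emptied : recent (h (suc m)) ≡ ⊥
        emptied rewrite recent-step m | c = refl
        q∈expected : q ∈ₛ expected (h m′)
        q∈expected rewrite cut⇒seen m<m′ c | recurrent-constant m′ = q∈S
      ...     | j , m<j , q∈f = j , ≤-trans N≤m (<⇒≤ m<j) , q∈f

      from : Recurrent (λ m → q ∈ₛ f m) → q ∈ₛ recurrent (h 0)
      from rec with cuts 0
      ... | m , _ , c with rec (suc m)
      ...   | m′ , m<m′ , q∈f with occurs⇒checked m′ q∈f
      ...     | m″ , m′≤m″ , q∈expected
        rewrite cut⇒seen (≤-trans m<m′ m′≤m″) c | recurrent-constant m″ = q∈expected

    occurring-correct : ∀ q → q ∈ₛ occurring (h 0) ⇔ (∃[ m ] (q ∈ₛ f m))
    occurring-correct q = mk⇔ to from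
      where
      to : q ∈ₛ occurring (h 0) → ∃[ m ] (q ∈ₛ f m)
      to q∈ with x∈p∪q⁻ _ _ q∈
      ... | inj₁ q∈S = case Equivalence.to (recurrent-correct q) q∈S 0 of λ
        { (m , _ , q∈f) → m , q∈f }
      ... | inj₂ q∈R with cuts 0
      ...   | m , _ , c with seen⇒firstCut (suc m) (cut⇒seen ≤-refl c)
      ...     | m′ , _ , c′ , s with checked⇒occurs recent-start z≤n c′ q∈expected
        where
        q∈expected : q ∈ₛ expected (h m′)
        q∈expected rewrite s | transient-constant m′ = q∈R
      ...       | j , _ , q∈f = j , q∈f

      from : ∃[ m ] (q ∈ₛ f m) → q ∈ₛ occurring (h 0)
      from (m , q∈f) with occurs⇒checked m q∈f
      ... | m′ , _ , q∈expected with seen (h m′)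
      ...   | true  rewrite recurrent-constant m′ = p⊆p∪q _ q∈expected
      ...   | false rewrite transient-constant m′ = q⊆p∪q _ _ q∈expected

-- Scheduling the cuts of countably many rows

<ᵇ-true : ∀ {m n} → m < n → (m <ᵇ n) ≡ true
<ᵇ-true = Equivalence.to T-≡ ∘ <⇒<ᵇ

<ᵇ-true⁻ : ∀ m n → (m <ᵇ n) ≡ true → m < n
<ᵇ-true⁻ m n = <ᵇ⇒< m n ∘ Equivalence.from T-≡

<ᵇ-irrefl : ∀ m → (m <ᵇ m) ≡ false
<ᵇ-irrefl m = dec-false (m <? m) (<-irrefl refl)

<ᵇ-suc-∨ : ∀ n i → (n <ᵇ suc i) ≡ (n <ᵇ i) ∨ (n <ᵇ suc i)
<ᵇ-suc-∨ zero    zero    = refl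
<ᵇ-suc-∨ zero    (suc i) = refl
<ᵇ-suc-∨ (suc n) zero    = refl
<ᵇ-suc-∨ (suc n) (suc i) = <ᵇ-suc-∨ n i

<ᵇ-suc-∧ : ∀ n i → (n <ᵇ i) ≡ (n <ᵇ suc i) ∧ (n <ᵇ i)
<ᵇ-suc-∧ zero    i       = refl
<ᵇ-suc-∧ (suc n) zero    with n <ᵇ 0
... | true  = refl
... | false = refl
<ᵇ-suc-∧ (suc n) (suc i) = <ᵇ-suc-∧ n i

maxUpTo : (ℕ → ℕ) → ℕ → ℕ
maxUpTo g zero    = g 0
maxUpTo g (suc i) = maxUpTo g i ⊔ g (suc i)

≤maxUpTo : ∀ g {n i} → n ≤ i → g n ≤ maxUpTo g i
≤maxUpTo g {n} {zero}  z≤n = ≤-refl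
≤maxUpTo g {n} {suc i} n≤1+i with m≤n⇒m<n∨m≡n n≤1+i
... | inj₁ (s≤s n≤i) = ≤-trans (≤maxUpTo g n≤i) (m≤m⊔n _ _)
... | inj₂ refl      = m≤n⊔m _ _

common-bound : ∀ {k} {P : Fin k → ℕ → Set} → (∀ {q M N} → M ≤ N → P q M → P q N) →
               (∀ q → ∃[ N ] P q N) → ∃[ N ] (∀ q → P q N)
common-bound {zero}  up each = 0 , λ ()
common-bound {suc k} up each with each zero | common-bound up (each ∘ suc)
... | N₀ , P₀ | N , Ps = N₀ ⊔ N , λ
  { zero    → up (m≤m⊔n N₀ N) P₀
  ; (suc q) → up (m≤n⊔m N₀ N) (Ps q) }

-- S is the limit superior of f, with effective bounds: f stays inside S from
-- some index on, and every N has an M such that each element of S occurs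
-- between N and M.
record LimSup {k} (f : ℕ → Subset k) (S : Subset k) : Set where
  field
    settles : ∃[ N ] (∀ m → N ≤ m → f m ⊆ S)
    recurs  : ∀ N → ∃[ M ] (∀ q → q ∈ₛ S → ∃[ j ] (N ≤ j × j ≤ M × q ∈ₛ f j))

-- Excluded middle provides, for q outside S, an index from which q is absent.
limSup : ExcludedMiddle 0ℓ → ∀ {k} {f : ℕ → Subset k} {S} →
         (∀ q → q ∈ₛ S ⇔ Recurrent (λ m → q ∈ₛ f m)) → LimSup f S
limSup em {k} {f} {S} S-rec = record
  { settles = case common-bound (λ M≤N P m N≤m → P m (≤-trans M≤N N≤m)) settle of λ
      { (N , settled) → N , λ m N≤m {q} q∈f → settled q m N≤m q∈f }
  ; recurs  = λ N → common-bound
      (λ M≤N P q∈S → case P q∈S of λ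
        { (j , N≤j , j≤M , q∈f) → j , N≤j , ≤-trans j≤M M≤N , q∈f })
      (recur N)
  }
  where
  settle : ∀ q → ∃[ N ] (∀ m → N ≤ m → q ∈ₛ f m → q ∈ₛ S)
  settle q with em {∃[ N ] (∀ m → N ≤ m → ¬ (q ∈ₛ f m))}
  ... | yes (N , none) = N , λ m N≤m q∈f → ⊥-elim (none m N≤m q∈f)
  ... | no  never      = 0 , λ _ _ _ → Equivalence.from (S-rec q) rec
    where
    rec : Recurrent (λ m → q ∈ₛ f m)
    rec N with em {∃[ m ] (N ≤ m × q ∈ₛ f m)}
    ... | yes found = found
    ... | no  none  = ⊥-elim (never (N , λ m N≤m q∈f → none (m , N≤m , q∈f)))

  recur : ∀ N q → ∃[ M ] (q ∈ₛ S → ∃[ j ] (N ≤ j × j ≤ M × q ∈ₛ f j))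
  recur N q with q ∈? S
  ... | no  q∉S = 0 , λ q∈S → contradiction q∈S q∉S
  ... | yes q∈S with Equivalence.to (S-rec q) q∈S N
  ...   | m , N≤m , q∈f = m , λ _ → m , N≤m , ≤-refl , q∈f

-- Tracks for all the sequences f n at once, certifying S n, where the cuts of
-- row n + 1 are those of row n without the first.  Row n has its first cut at
-- a column not smaller than n.
record Grid {k} (f : ℕ → ℕ → Subset k) (S : ℕ → Subset k) : Set where
  field
    grid       : ℕ → ℕ → Track k
    tracks     : ∀ n → Tracks (f n) (grid n)
    recurrent≡ : ∀ n → recurrent (grid n 0) ≡ S n
    drop-first : ∀ n m → cut (grid (suc n) m) ≡ cut (grid n m) ∧ seen (grid n m)
    corner     : ∀ n → ∃[ m ] (n ≤ m × FirstCut (grid n m))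
    cuts       : ∀ n → Recurrent (λ m → Cut (grid n m))

module Schedule {k} {f : ℕ → ℕ → Subset k} {S : ℕ → Subset k}
                (limsup : ∀ n → LimSup (f n) (S n)) where
  open module L n = LimSup (limsup n)

  settled : ℕ → ℕ
  settled n = proj₁ (settles n)

  -- Between m and nextRound m n, every element of S n occurs in row n.
  nextRound : ℕ → ℕ → ℕ
  nextRound m n = proj₁ (recurs n m)

  -- The columns of the cuts; row n is cut at c n, c (n + 1), and so on.  The
  -- three bounds make the columns increase, let row i + 1 settle before its
  -- first cut, and let rows 0 to i complete a block after c i.
  c : ℕ → ℕ
  c zero    = settled 0
  c (suc i) = suc (c i) ⊔ (settled (suc i) ⊔ maxUpTo (nextRound (suc (c i))) i)

  c-step : ∀ i → c i < c (suc i)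
  c-step i = m≤m⊔n (suc (c i)) (settled (suc i) ⊔ maxUpTo (nextRound (suc (c i))) i)

  settled≤c : ∀ n → settled n ≤ c n
  settled≤c zero    = ≤-refl
  settled≤c (suc n) = ≤-trans (m≤m⊔n (settled (suc n)) _) (m≤n⊔m (suc (c n)) _)

  nextRound≤c : ∀ {n i} → n ≤ i → nextRound (suc (c i)) n ≤ c (suc i)
  nextRound≤c {n} {i} n≤i =
    ≤-trans (≤maxUpTo (nextRound (suc (c i))) n≤i)
      (≤-trans (m≤n⊔m (settled (suc i)) _) (m≤n⊔m (suc (c i)) _))

  c-grows : ∀ i → i ≤ c i
  c-grows zero    = z≤n
  c-grows (suc i) = ≤-trans (s≤s (c-grows i)) (c-step i)

  c-settled : ∀ n j → c n ≤ j → f n j ⊆ S n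
  c-settled n j c≤j = proj₂ (settles n) j (≤-trans (settled≤c n) c≤j)

  c-recurs : ∀ {n i q} → n ≤ i → q ∈ₛ S n → ∃[ j ] (c i < j × j ≤ c (suc i) × q ∈ₛ f n j)
  c-recurs {n} {i} n≤i q∈S with proj₂ (recurs n (suc (c i))) _ q∈S
  ... | j , c<j , j≤M , q∈f = j , c<j , ≤-trans j≤M (nextRound≤c n≤i) , q∈f

  -- The number of i such that c i < m.
  count : ℕ → ℕ
  count zero    = 0
  count (suc m) = if does (m ≟ c (count m)) then suc (count m) else count m

  -- Whether m is one of the c i.
  column : ℕ → Bool
  column m = does (m ≟ c (count m))

  -- The m with count m ≡ i are those after c (i - 1) and up to c i.  Hence row
  -- n is cut at m if m is a cut column and n ≤ count m.
  cutAt seenAt : ℕ → ℕ → Bool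
  cutAt  n m = column m ∧ (n <ᵇ suc (count m))
  seenAt n m = n <ᵇ count m

  recentAt : ℕ → ℕ → Subset k
  recentAt n zero    = ⊥
  recentAt n (suc m) = if cutAt n m then ⊥ else recentAt n m ∪ f n m

  -- The union of the first block of row n, whatever it is.
  transientOf : ℕ → Subset k
  transientOf n = recentAt n (c n) ∪ f n (c n)

  count-suc : ∀ m → (m ≡ c (count m) × count (suc m) ≡ suc (count m) × column m ≡ true)
                  ⊎ (¬ m ≡ c (count m) × count (suc m) ≡ count m × column m ≡ false)
  count-suc m with m ≟ c (count m)
  ... | yes eq = inj₁ (eq , cong (if_then suc (count m) else count m) col , col)
    where col = dec-true (m ≟ c (count m)) eq
  ... | no  ne = inj₂ (ne , cong (if_then suc (count m) else count m) col , col)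
    where col = dec-false (m ≟ c (count m)) ne

  count-at-c : ∀ i → count (c i) ≡ i

  -- The count keeps the value i until c i is reached.
  wait : ∀ i d m → count m ≡ i → m + d ≡ c i → count (c i) ≡ i
  wait i zero    m eq m≡c = subst (λ m → count m ≡ i) (trans (sym (+-identityʳ m)) m≡c) eq
  wait i (suc d) m eq m<c with count-suc m
  ... | inj₂ (_ , same , _) = wait i d (suc m) (trans same eq) (trans (sym (+-suc m d)) m<c)
  ... | inj₁ (m≡c , _) = contradiction (trans m≡c (cong c eq))
    (<⇒≢ (subst (m <_) m<c (m<m+n m (s≤s z≤n))))

  count-at-c zero    = wait zero (c 0) 0 refl refl
  count-at-c (suc i) with m≤n⇒∃[o]m+o≡n (c-step i) | count-suc (c i)
  ... | d , eq | inj₁ (_ , next , _) =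
    wait (suc i) d (suc (c i)) (trans next (cong suc (count-at-c i))) eq
  ... | d , eq | inj₂ (ne , _) = contradiction (cong c (sym (count-at-c i))) ne

  column-c : ∀ i → column (c i) ≡ true
  column-c i = dec-true (c i ≟ _) (cong c (sym (count-at-c i)))

  counted⇒past : ∀ {n} m → n < count m → c n < m
  counted⇒past (suc m) n< with count-suc m
  ... | inj₂ (_ , same , _) = m≤n⇒m≤1+n (counted⇒past m (subst (_ <_) same n<))
  ... | inj₁ (m≡c , next , _) with m≤n⇒m<n∨m≡n (≤-pred (subst (_ <_) next n<))
  ...   | inj₁ n<count = m≤n⇒m≤1+n (counted⇒past m n<count)
  ...   | inj₂ refl    = s≤s (≤-reflexive (sym m≡c))

  -- Once row n has had its first cut, it only collects elements of S n.
  recent⊆S : ∀ {n} m → n < count m → recentAt n m ⊆ S n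
  recent⊆S {n} (suc m) n< q∈ with count-suc m
  ... | inj₁ (_ , next , col)
    rewrite col | <ᵇ-true (subst (n <_) next n<) = ⊥-elim (∉⊥ q∈)
  ... | inj₂ (_ , same , col) rewrite col with x∈p∪q⁻ _ _ q∈
  ...   | inj₁ q∈recent = recent⊆S m (subst (n <_) same n<) q∈recent
  ...   | inj₂ q∈f      =
    c-settled n m (<⇒≤ (counted⇒past m (subst (n <_) same n<))) q∈f

  -- Once row n has had its first cut, each element of S n either lies in the
  -- current block of the row already or still occurs by the end of the block.
  S-pending : ∀ {n q} m → n < count m → q ∈ₛ S n →
              q ∈ₛ recentAt n m ⊎ (∃[ j ] (m ≤ j × j ≤ c (count m) × q ∈ₛ f n j))
  S-pending {n} {q} (suc m) n< q∈S with count-suc m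
  ... | inj₁ (m≡c , next , _) with c-recurs (≤-pred (subst (n <_) next n<)) q∈S
  ...   | j , c<j , j≤c , q∈f =
    inj₂ (j , subst (_< j) (sym m≡c) c<j , subst (λ i → j ≤ c i) (sym next) j≤c , q∈f)
  S-pending {n} {q} (suc m) n< q∈S | inj₂ (_ , same , col)
    rewrite col | same with S-pending m n< q∈S
  ... | inj₁ q∈recent = inj₁ (x∈p∪q⁺ (inj₁ q∈recent))
  ... | inj₂ (j , m≤j , j≤c , q∈f) with m≤n⇒m<n∨m≡n m≤j
  ...   | inj₁ m<j  = inj₂ (j , m<j , j≤c , q∈f)
  ...   | inj₂ refl = inj₁ (x∈p∪q⁺ (inj₂ q∈f))

  trackAt : ℕ → ℕ → Track k
  trackAt n m = record
    { recurrent = S n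
    ; transient = transientOf n
    ; recent    = recentAt n m
    ; seen      = seenAt n m
    ; cut       = cutAt n m
    }

  seenAt-suc : ∀ n m → seenAt n (suc m) ≡ seenAt n m ∨ cutAt n m
  seenAt-suc n m with count-suc m
  ... | inj₁ (_ , next , col) rewrite next | col = <ᵇ-suc-∨ n (count m)
  ... | inj₂ (_ , same , col) rewrite same | col = sym (∨-identityʳ _)

  checkAt : ∀ n m → cutAt n m ≡ true → recentAt n m ∪ f n m ≡ expected (trackAt n m)
  checkAt n m cut≡ with count-suc m
  ... | inj₂ (_ , _ , col) =
    case trans (sym cut≡) (cong (_∧ (n <ᵇ suc (count m))) col) of λ ()
  ... | inj₁ (m≡c , _ , col) with seenAt n m in seen≡
  ...   | true  = ⊆-antisym ⊆S S⊆
    where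
    n<count = <ᵇ-true⁻ n (count m) seen≡
    ⊆S : recentAt n m ∪ f n m ⊆ S n
    ⊆S q∈ with x∈p∪q⁻ _ _ q∈
    ... | inj₁ q∈recent = recent⊆S m n<count q∈recent
    ... | inj₂ q∈f      = c-settled n m (<⇒≤ (counted⇒past m n<count)) q∈f

    S⊆ : S n ⊆ recentAt n m ∪ f n m
    S⊆ q∈S with S-pending m n<count q∈S
    ... | inj₁ q∈recent = x∈p∪q⁺ (inj₁ q∈recent)
    -- At a cut, m = c (count m), so the only index left is m itself.
    ... | inj₂ (j , m≤j , j≤c , q∈f)
      with ≤-antisym m≤j (≤-trans j≤c (≤-reflexive (sym m≡c)))
    ...   | refl = x∈p∪q⁺ (inj₂ q∈f)
  ...   | false = cong (λ m → recentAt n m ∪ f n m) (trans m≡c (cong c (sym n≡count)))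
    where
    n≤count : n ≤ count m
    n≤count = ≤-pred (<ᵇ-true⁻ n (suc (count m))
      (trans (cong (_∧ (n <ᵇ suc (count m))) (sym col)) cut≡))

    n≡count : n ≡ count m
    n≡count with m≤n⇒m<n∨m≡n n≤count
    ... | inj₂ eq = eq
    ... | inj₁ n<count = case trans (sym seen≡) (<ᵇ-true n<count) of λ ()

  schedule : Grid f S
  schedule = record
    { grid       = trackAt
    ; tracks     = λ n → record
      { start = record { recent-start = refl ; seen-start = refl }
      ; step  = λ m → record
        { recurrent-step = refl
        ; transient-step = refl
        ; recent-step    = refl
        ; seen-step      = seenAt-suc n m
        ; check          = checkAt n m } }
    ; recurrent≡ = λ n → refl
    ; drop-first = λ n m →
        trans (cong (column m ∧_) (<ᵇ-suc-∧ n (count m))) (sym (∧-assoc (column m) _ _))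
    ; corner     = λ n →
        c n , c-grows n , cutAt-c n n ≤-refl ,
        trans (cong (n <ᵇ_) (count-at-c n)) (<ᵇ-irrefl n)
    ; cuts       = λ n N →
        c (n ⊔ N) , ≤-trans (m≤n⊔m n N) (c-grows (n ⊔ N)) , cutAt-c n (n ⊔ N) (m≤m⊔n n N)
    }
    where
    cutAt-c : ∀ n i → n ≤ i → cutAt n (c i) ≡ true
    cutAt-c n i n≤i rewrite column-c i | count-at-c i = <ᵇ-true (s≤s n≤i)

-- The tiling system simulating an ordinal automaton

×-finite : ∀ {A B} → Finite A → Finite B → Finite (A × B)
×-finite (_ , A↔) (_ , B↔) = _ , ↔-trans (A↔ ×-↔ B↔) (↔-sym Fin.*↔×)

Bool-finite : Finite Bool
Bool-finite = 2 , ↔-sym Fin.2↔Bool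

Subset-finite : ∀ k → Finite (Subset k)
Subset-finite zero    = 1 , mk↔ₛ′ (λ _ → zero) (λ _ → []) (λ { zero → refl }) (λ { [] → refl })
Subset-finite (suc k) = _ , ↔-trans uncons (proj₂ (×-finite Bool-finite (Subset-finite k)))
  where
  uncons : Subset (suc k) ↔ (Bool × Subset k)
  uncons = mk↔ₛ′
    (λ { (b ∷ p) → b , p }) (λ { (b , p) → b ∷ p }) (λ _ → refl) (λ { (b ∷ p) → refl })

Track-finite : ∀ k → Finite (Track k)
Track-finite k = _ , ↔-trans fields (proj₂ fields-finite)
  where
  fields-finite = ×-finite (Subset-finite k) (×-finite (Subset-finite k)
                    (×-finite (Subset-finite k) (×-finite Bool-finite Bool-finite)))

  fields : Track k ↔ (Subset k × Subset k × Subset k × Bool × Bool)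
  fields = mk↔ₛ′
    (λ (track S R T s c) → S , R , T , s , c) (λ (S , R , T , s , c) → track S R T s c)
    (λ _ → refl) (λ _ → refl)

module Simulation {A : Set} (ℬ : OrdinalBüchiAutomaton A) where
  open OrdinalBüchiAutomaton ℬ

  -- The states of the tiling system.  The label in column m and row n of a
  -- tiling carries the state at ω·n + m, a track along row n for the states of
  -- this row, and a track for the sets of states occurring in the successive
  -- rows.  The latter is constant along each row.
  record Label : Set where
    constructor label
    field
      state  : State
      across : Track states
      up     : Track states

  open Label

  -- From s to its right neighbour s′, reading a.
  record Rightward (a : A) (s s′ : Label) : Set where
    field
      transition  : Δ (state s , a , state s′)
      across-step : Step ⁅ state s ⁆ (across s) (across s′)
      up-const    : up s′ ≡ up s

  -- From s to its upper neighbour s′.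
  record Upward (s s′ : Label) : Set where
    field
      drop-first : cut (across s′) ≡ cut (across s) ∧ seen (across s)

  -- From the first label s of a row to the first label s′ of the next row.
  -- The sets in the track of s already describe its entire row.
  record Leftmost (s s′ : Label) : Set where
    field
      across-start : Start (across s)
      up-step      : Step (occurring (across s)) (up s) (up s′)
      limitRow     : γ (recurrent (across s) , state s′)

  -- The label of the first position.
  record Origin (s : Label) : Set where
    field
      initial    : state s ≡ q₀
      up-start   : Start (up s)
      limitFinal : ∃[ q ] (γ (recurrent (up s) , q) × q ∈ₛ F)

  -- A tile at (m , n) reads its upper right letter, which is the letter of
  -- the row word at (n , m).  A border letter at the upper left means m = 0,
  -- and one at the lower right means n = 0.
  record Tile (a₂ a₃ a₄ : Maybe A) (s₁ s₂ s₃ : Label) : Set where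
    field
      rightward : ∀ a → a₄ ≡ just a → Rightward a s₁ s₂
      upward    : Upward s₁ s₃
      leftmost  : a₃ ≡ # → Leftmost s₁ s₃
      origin    : a₂ ≡ # → a₃ ≡ # → Origin s₁

  -- Final labels: the first cut of a row at which the upward track is cut.
  Accepting : Label → Set
  Accepting s = FirstCut (across s) × Cut (up s)

  InfinitelyAccepting : (ℕ → ℕ → Label) → Set
  InfinitelyAccepting s = Infinite {ℕ × ℕ} (λ v → Accepting (s (proj₂ v) (proj₁ v)))

  accepting : Label → Bool
  accepting s = (cut (across s) ∧ not (seen (across s))) ∧ cut (up s)

  accepting⇔ : ∀ s → accepting s ≡ true ⇔ Accepting s
  accepting⇔ s = mk⇔ to from
    where
    to : accepting s ≡ true → Accepting s
    to eq with cut (across s) | seen (across s) | cut (up s)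
    to refl | true | false | true = (refl , refl) , refl
    from : Accepting s → accepting s ≡ true
    from ((c , ¬s) , c′) rewrite c | ¬s | c′ = refl

  Label-finite : Finite Label
  Label-finite = _ , ↔-trans fields (proj₂ fields-finite)
    where
    fields-finite =
      ×-finite (states , ↔-refl) (×-finite (Track-finite states) (Track-finite states))

    fields : Label ↔ (State × Track states × Track states)
    fields = mk↔ₛ′
      (λ (label q h v) → q , h , v) (λ (q , h , v) → label q h v)
      (λ _ → refl) (λ _ → refl)

  open Inverse (proj₂ Label-finite) using ()
    renaming (to to encode; from to decode; strictlyInverseʳ to decode-encode)

  𝒜 : TilingSystem A
  𝒜 = record
    { states = proj₁ Label-finite
    ; Δ      = λ { ((_ , s₁) , (a₂ , s₂) , (a₃ , s₃) , (a₄ , _)) →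
                   Tile a₂ a₃ a₄ (decode s₁) (decode s₂) (decode s₃) }
    }

  𝒜-final : Subset (TilingSystem.states 𝒜)
  𝒜-final = tabulate (accepting ∘ decode)

  ∈final⇔ : ∀ s → s ∈ₛ 𝒜-final ⇔ Accepting (decode s)
  ∈final⇔ s = ⇔-trans
    (mk⇔ (λ s∈ → trans (sym (lookup∘tabulate (accepting ∘ decode) s)) ([]=⇒lookup s∈))
         (λ eq → lookup⇒[]= s 𝒜-final (trans (lookup∘tabulate (accepting ∘ decode) s) eq)))
    (accepting⇔ (decode s))

  -- The decoded form of a tiling run: s n m is the label in row n and column m,
  -- and letter and border conditions have been resolved.
  record Labelling (σ : Word A ω²) (s : ℕ → ℕ → Label) : Set where
    field
      rightward : ∀ n m → Rightward (σ (n , m)) (s n m) (s n (suc m))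
      upward    : ∀ n m → Upward (s n m) (s (suc n) m)
      leftmost  : ∀ n → Leftmost (s n 0) (s (suc n) 0)
      origin    : Origin (s 0 0)

  tiling⇒labelling : ∀ p {ρ} → IsTilingRun 𝒜 p ρ →
                     Labelling (rowWord p) (λ n m → decode (ρ (m , n)))
  tiling⇒labelling p tiles = record
    { rightward = λ n m → Tile.rightward (tiles m n) _ (proj₂ (interior p m n))
    ; upward    = λ n m → Tile.upward (tiles m n)
    ; leftmost  = λ n → Tile.leftmost (tiles 0 n) (left p (suc n))
    ; origin    = Tile.origin (tiles 0 0) (bottom p 1) (left p 1)
    }

  labelling⇒tiling : ∀ p {s} → Labelling (rowWord p) s →
                     IsTilingRun 𝒜 p (λ v → encode (s (proj₂ v) (proj₁ v)))
  labelling⇒tiling p {s} lab i j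
    rewrite decode-encode (s j i) | decode-encode (s j (suc i)) | decode-encode (s (suc j) i) = record
    { rightward = λ a eq → subst (λ a → Rightward a (s j i) (s j (suc i)))
                                 (letter-unique p i j eq) (rightward j i)
    ; upward    = upward j i
    ; leftmost  = leftmost-tile i
    ; origin    = origin-tile i j
    }
    where
    open Labelling lab
    leftmost-tile : ∀ i → at p (i , suc j) ≡ # → Leftmost (s j i) (s (suc j) i)
    leftmost-tile zero    _  = leftmost j
    leftmost-tile (suc i) eq = case trans (sym (proj₂ (interior p i j))) eq of λ ()

    origin-tile : ∀ i j → at p (suc i , j) ≡ # → at p (i , suc j) ≡ # → Origin (s j i)
    origin-tile zero    zero    _  _  = origin
    origin-tile i       (suc j) eq _  = case trans (sym (proj₂ (interior p i j))) eq of λ ()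
    origin-tile (suc i) zero    _  eq = case trans (sym (proj₂ (interior p i 0))) eq of λ ()

  module _ {σ s} (lab : Labelling σ s) where
    open Labelling lab

    rowTracks : ∀ n → Tracks (λ m → ⁅ state (s n m) ⁆) (λ m → across (s n m))
    rowTracks n = record
      { start = Leftmost.across-start (leftmost n)
      ; step  = λ m → Rightward.across-step (rightward n m)
      }

    columnTracks : Tracks (λ n → occurring (across (s n 0))) (λ n → up (s n 0))
    columnTracks = record
      { start = Origin.up-start origin
      ; step  = λ n → Leftmost.up-step (leftmost n)
      }

    up-constant : ∀ n m → up (s n m) ≡ up (s n 0)
    up-constant n zero    = refl
    up-constant n (suc m) = trans (Rightward.up-const (rightward n m)) (up-constant n m)

    cut-below : ∀ n m → Cut (across (s (suc n) m)) →
                Cut (across (s n m)) × seen (across (s n m)) ≡ true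
    cut-below n m c with cut (across (s n m)) | seen (across (s n m)) | Upward.drop-first (upward n m)
    ... | true  | true  | _  = refl , refl
    ... | true  | false | eq = case trans (sym c) eq of λ ()
    ... | false | _     | eq = case trans (sym c) eq of λ ()

    cut-belowᵈ : ∀ n d m → Cut (across (s (n + d) m)) → Cut (across (s n m))
    cut-belowᵈ n zero    m c rewrite +-identityʳ n = c
    cut-belowᵈ n (suc d) m c rewrite +-suc n d = cut-belowᵈ n d m (proj₁ (cut-below (n + d) m c))

    -- Each row loses the first cut of the row below, so its cuts start later.
    cut⇒row≤column : ∀ n m → Cut (across (s n m)) → n ≤ m
    cut⇒row≤column zero    m c = z≤n
    cut⇒row≤column (suc n) m c
      with Tracking.seen⇒firstCut (rowTracks n) m (proj₂ (cut-below n m c))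
    ... | m′ , m′<m , c′ , _ = ≤-trans (s≤s (cut⇒row≤column n m′ c′)) m′<m

    module _ (em : ExcludedMiddle 0ℓ) (infinite : InfinitelyAccepting s) where

      -- A list of all first cuts below row N; there is at most one in each row.
      lowCorners : ∀ N → ∃[ xs ] (∀ n m → n < N → FirstCut (across (s n m)) → (m , n) ∈ xs)
      lowCorners zero    = [] , λ _ _ ()
      lowCorners (suc N) with lowCorners N | em {∃[ m ] FirstCut (across (s N m))}
      ... | xs , all | no none = xs , λ n m n≤N c →
        case m≤n⇒m<n∨m≡n (≤-pred n≤N) of λ
        { (inj₁ n<N)  → all n m n<N c
        ; (inj₂ refl) → ⊥-elim (none (m , c)) }
      ... | xs , all | yes (m₀ , c₀) = (m₀ , N) ∷ xs , λ n m n≤N c →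
        case m≤n⇒m<n∨m≡n (≤-pred n≤N) of λ
        { (inj₁ n<N)  → there (all n m n<N c)
        ; (inj₂ refl) → here (cong (_, n) (Tracking.firstCut-unique (rowTracks n) c c₀)) }

      highAccepting : ∀ N → ∃[ n ] ∃[ m ] (N ≤ n × Accepting (s n m))
      highAccepting N with lowCorners N
      ... | xs , all with infinite xs
      ...   | (m , n) , ∉xs , acc@(c , _) = n , m , ≮⇒≥ (λ n<N → ∉xs (all n m n<N c)) , acc

      -- A first cut high up is a cut in row n, far to the right.
      rowCuts : ∀ n → Recurrent (λ m → Cut (across (s n m)))
      rowCuts n N with highAccepting (n ⊔ N)
      ... | n′ , m , n⊔N≤n′ , (c , _) , _ with m≤n⇒∃[o]m+o≡n (m⊔n≤o⇒m≤o n N n⊔N≤n′)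
      ...   | d , refl =
        m , ≤-trans (m⊔n≤o⇒n≤o n N n⊔N≤n′) (cut⇒row≤column (n + d) m c) , cut-belowᵈ n d m c

      columnCuts : Recurrent (λ n → Cut (up (s n 0)))
      columnCuts N with highAccepting N
      ... | n , m , N≤n , _ , c = n , N≤n , trans (cong cut (sym (up-constant n m))) c

      labelling⇒gridRun :
        GridRun ℬ σ (λ n m → state (s n m)) (proj₁ (Origin.limitFinal origin))
      labelling⇒gridRun = record
        { initial    = Origin.initial origin
        ; step       = λ n m → Rightward.transition (rightward n m)
        ; rowLimit   = λ n → recurrent (across (s n 0)) ,
            (λ q → ⇔-trans (Tracking.recurrent-correct (rowTracks n) (rowCuts n) q)
                           (Recurrent-cong λ m → singleton q (state (s n m)))) ,
            Leftmost.limitRow (leftmost n)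
        ; finalLimit = recurrent (up (s 0 0)) ,
            (λ q → ⇔-trans (Tracking.recurrent-correct columnTracks columnCuts q)
                     (Recurrent-cong λ n → ⇔-trans
                       (Tracking.occurring-correct (rowTracks n) (rowCuts n) q)
                       (∃-cong λ m → singleton q (state (s n m))))) ,
            proj₁ (proj₂ (Origin.limitFinal origin))
        }

  gridRun⇒labelling : ExcludedMiddle 0ℓ → ∀ {σ X top} → GridRun ℬ σ X top → top ∈ₛ F →
                      ∃[ s ] (Labelling σ s × InfinitelyAccepting s)
  gridRun⇒labelling em {σ} {X} {top} run top∈F = s , labelling , infinite
    where
    open GridRun run

    rowSet : ℕ → Subset states
    rowSet n = proj₁ (rowLimit n)

    rows : Grid (λ n m → ⁅ X n m ⁆) rowSet
    rows = Schedule.schedule λ n → limSup em λ q →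
      ⇔-trans (proj₁ (proj₂ (rowLimit n)) q) (⇔-sym (Recurrent-cong λ m → singleton q (X n m)))

    module Rows = Grid rows

    finalSet : Subset states
    finalSet = proj₁ finalLimit

    -- A single sequence is needed here; it is scheduled as row 0 of a constant
    -- family.
    column : Grid (λ _ n → occurring (Rows.grid n 0)) (λ _ → finalSet)
    column = Schedule.schedule λ _ → limSup em λ q →
      ⇔-trans (proj₁ (proj₂ finalLimit) q) (⇔-sym (Recurrent-cong λ n →
        ⇔-trans (Tracking.occurring-correct (Rows.tracks n) (Rows.cuts n) q)
                (∃-cong λ m → singleton q (X n m))))

    module Column = Grid column

    s : ℕ → ℕ → Label
    s n m = label (X n m) (Rows.grid n m) (Column.grid 0 n)

    labelling : Labelling σ s
    labelling = record
      { rightward = λ n m → record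
        { transition  = step n m
        ; across-step = Tracks.step (Rows.tracks n) m
        ; up-const    = refl }
      ; upward    = λ n m → record { drop-first = Rows.drop-first n m }
      ; leftmost  = λ n → record
        { across-start = Tracks.start (Rows.tracks n)
        ; up-step      = Tracks.step (Column.tracks 0) n
        ; limitRow     = subst (λ S → γ (S , X (suc n) 0)) (sym (Rows.recurrent≡ n))
                               (proj₂ (proj₂ (rowLimit n))) }
      ; origin    = record
        { initial    = initial
        ; up-start   = Tracks.start (Column.tracks 0)
        ; limitFinal = top , subst (λ S → γ (S , top)) (sym (Column.recurrent≡ 0))
                                   (proj₂ (proj₂ finalLimit)) , top∈F }
      }

    infinite : InfinitelyAccepting s
    -- The first cuts of the rows at which the upward track is cut.
    infinite xs =
      let N , xs≤N           = bound xs
          n , N<n , cut-n    = Column.cuts 0 (suc N)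
          m , n≤m , corner-n = Rows.corner n
      in (m , n) , (λ v∈xs → <-irrefl refl (≤-trans (≤-trans N<n n≤m) (xs≤N m n v∈xs))) ,
         corner-n , cut-n

  recognizes-accepted : ExcludedMiddle 0ℓ → ∀ p →
    Accepted ℬ ω² (rowWord p) ⇔ BüchiLanguage 𝒜 𝒜-final p
  recognizes-accepted em p = mk⇔ to from
    where
    to : Accepted ℬ ω² (rowWord p) → BüchiLanguage 𝒜 𝒜-final p
    to (x , run , top∈F) =
      let s , labelling , infinite = gridRun⇒labelling em (run⇒gridRun ℬ run) top∈F
      in _ , labelling⇒tiling p labelling , λ xs →
         let v , v∉xs , acc = infinite xs
         in v , v∉xs , Equivalence.from (∈final⇔ _)
              (subst Accepting (sym (decode-encode (s (proj₂ v) (proj₁ v)))) acc)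

    from : BüchiLanguage 𝒜 𝒜-final p → Accepted ℬ ω² (rowWord p)
    from (ρ , tiles , infinite) = _ ,
      gridRun⇒run ℬ (labelling⇒gridRun lab em λ xs → case infinite xs of λ
        { (v , v∉xs , v∈F) → v , v∉xs , Equivalence.to (∈final⇔ _) v∈F }) ,
      proj₂ (proj₂ (Origin.limitFinal (Labelling.origin lab)))
      where lab = tiling⇒labelling p tiles

-- By the extensionality of L, membership of p only depends on its row word.
rowByRow⇒recognizable : ExcludedMiddle 0ℓ → {A : Set} (L : Language A) →
                        AcceptedRowByRow L → BüchiRecognizable L
rowByRow⇒recognizable em L (ℬ , words⊆acc , acc⊆words) = 𝒜 , 𝒜-final ,
  (λ {p} p∈L → Equivalence.to (recognizes-accepted em p) (words⊆acc (p , p∈L , λ _ → refl))) ,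
  (λ {p} p∈B → case acc⊆words (Equivalence.from (recognizes-accepted em p) p∈B) of λ
    { (p′ , p′∈L , same) → respects L (≈-fromLetters p′ p λ i j → same (j , i)) p′∈L })
  where open Simulation ℬ

theorem4p1 : (ExcludedMiddle 0ℓ →
    (A : Set) → Finite A → (L : Language A) →
    AcceptedRowByRow L → BüchiRecognizable L)
    ×
    (Σ[ A ∈ Set ] (Finite A × Σ[ L ∈ Language A ]
    (BüchiRecognizable L × ¬ AcceptedRowByRow L)))
theorem4p1 =
  (λ em A _ L → rowByRow⇒recognizable em L) ,
  (Bool , Bool-finite , constantColumns ,
   constantColumns-recognizable , constantColumns-not-rowByRow)
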